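{- Let $t\ge 2$ and $k\ge 2$ be integers. Then there is a constant $c_{t,k}>0$ depending only on $t$ and $k$ such that for all sufficiently large $n$, \[ \operatorname{br}_k(C_{2t};K_{n,n}) \le \frac{c_{t,k}\, n^2}{\log^2 n}. \]
   Context: $C_{2t}$ denotes the cycle of length $2t$ and $K_{n,n}$ the complete bipartite graph with both parts of size $n$. For bipartite graphs $G_1,G_2$ and an integer $k\ge1$, the multicolor bipartite Ramsey number $\operatorname{br}_k(G_1;G_2)$ is the least integer $N$ such that every coloring of the edges of $K_{N,N}$ with $k+1$ colors $1,\dots,k+1$ contains a monochromatic copy of $G_1$ in one of the colors $1,\dots,k$ or a monochromatic copy of $G_2$ in color $k+1$. Rounding is ignored. -}

module Defs where

open import Data.Empty using (⊥)
open import Data.Fin using (Fin; toℕ; fromℕ; inject₁)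
open import Data.Integer using (+_; ∣_∣)
open import Data.Nat using (ℕ; suc; _^_; _≤_; _%_)
open import Data.Product using (∃-syntax; Σ-syntax; _×_; _,_)
open import Data.Rational as ℚ using (ℚ; NonNegative; ↥_; ↧ₙ_)
open import Data.Sum using (_⊎_; inj₁; inj₂; swap)
open import Data.Unit using (⊤)
open import Function using (_∘_)
open import Function.Definitions using (Injective)
open import Level using (0ℓ)
open import Relation.Binary.Core using (Rel)
open import Relation.Binary.Definitions using (Symmetric; Irreflexive)
open import Relation.Binary.PropositionalEquality using (_≡_; _≢_; refl; sym)

record Graph : Set₁ where
  field
    Vertex   : Set
    Adj      : Rel Vertex 0ℓ
    adj-sym  : Symmetric Adj
    adj-irr  : Irreflexive _≡_ Adj

open Graph public

-- G contains a copy of H, as a not necessarily induced subgraph.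
Contains : Graph → Graph → Set
Contains G H = Σ[ f ∈ (Vertex H → Vertex G) ]
  Injective _≡_ _≡_ f × (∀ {u v} → Adj H u v → Adj G (f u) (f v))

-- Every bipartite graph with parts Fin m and Fin n arises from a relation E
-- between the parts.
bipartite : (m n : ℕ) → (Fin m → Fin n → Set) → Graph
bipartite m n E = record
  { Vertex  = Fin m ⊎ Fin n
  ; Adj     = A
  ; adj-sym = λ {u} {v} → A-sym u v
  ; adj-irr = λ {u} → A-irr u
  }
  where
  A : Rel (Fin m ⊎ Fin n) 0ℓ
  A (inj₁ x) (inj₂ y) = E x y
  A (inj₂ y) (inj₁ x) = E x y
  A (inj₁ _) (inj₁ _) = ⊥
  A (inj₂ _) (inj₂ _) = ⊥

  A-sym : ∀ u v → A u v → A v u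
  A-sym (inj₁ _) (inj₂ _) e = e
  A-sym (inj₂ _) (inj₁ _) e = e

  A-irr : ∀ u {v} → u ≡ v → A u v → ⊥
  A-irr (inj₁ _) refl ()
  A-irr (inj₂ _) refl ()

completeBipartite : ℕ → ℕ → Graph
completeBipartite m n = bipartite m n (λ _ _ → ⊤)

Succ : ∀ {m} → Rel (Fin m) 0ℓ
Succ {suc m} i j = toℕ j ≡ suc (toℕ i) % suc m

-- The condition i ≢ j only matters for m = 1, where it excludes a loop;
-- this is the usual cycle for m ≥ 3.
cycle : ℕ → Graph
cycle m = record
  { Vertex  = Fin m
  ; Adj     = λ i j → i ≢ j × (Succ i j ⊎ Succ j i)
  ; adj-sym = λ (i≢j , s) → i≢j ∘ sym , swap s
  ; adj-irr = λ i≡j (i≢j , _) → i≢j i≡j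
  }

-- Since x ranges over the first part and y over the second, a function of
-- (x , y) is a colouring of the edges of the complete bipartite graph.
EdgeColouring : ℕ → ℕ → Set
EdgeColouring N r = Fin N → Fin N → Fin r

colourClass : ∀ {N r} → EdgeColouring N r → Fin r → Graph
colourClass {N} χ i = bipartite N N (λ x y → χ x y ≡ i)

-- inject₁ enumerates the first k of the k + 1 colours; fromℕ k is the last.
Arrows : ℕ → Graph → Graph → ℕ → Set
Arrows k G₁ G₂ N = (χ : EdgeColouring N (suc k)) →
    (∃[ i ] Contains (colourClass χ (inject₁ i)) G₁)
  ⊎ Contains (colourClass χ (fromℕ k)) G₂

-- br k (G₁ ; G₂) = N, as a relation because "the least N" is not known to
-- exist for arbitrary G₁ and G₂.
IsBr : ℕ → Graph → Graph → ℕ → Set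
IsBr k G₁ G₂ N = Arrows k G₁ G₂ N × (∀ M → Arrows k G₁ G₂ M → N ≤ M)

fromNat : ℕ → ℚ
fromNat n = + n ℚ./ 1

-- For q = a / b ≥ 0 and n ≥ 1: a / b ≤ log₂ n iff 2 ^ a ≤ n ^ b.
_≤log₂_ : ℚ → ℕ → Set
q ≤log₂ n = 2 ^ ∣ ↥ q ∣ ≤ n ^ ↧ₙ q

-- For n ≥ 2, the inequality N ≤ c n² / (log₂ n)² between real numbers: as
-- log₂ n is the supremum of the rationals q ≥ 0 below it, N (log₂ n)² ≤ c n²
-- holds iff N q² ≤ c n² for all such q. The logarithm is not rounded.
_≤_·n²/log²_ : ℕ → ℚ → ℕ → Set
N ≤ c ·n²/log² n = ∀ q → NonNegative q → q ≤log₂ n →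
  fromNat N ℚ.* (q ℚ.* q) ℚ.≤ c ℚ.* (fromNat n ℚ.* fromNat n)

{-# OPTIONS --safe #-}
-- Let N = s² with s of order n / log n. A graph between two sets of size N with
-- at least 2 (t + 1) s³ edges contains C₂ₜ, by dependent random choice: for some
-- vertex y only a small fraction of the pairs of neighbours of y have fewer than
-- t common neighbours, so t neighbours of y can be chosen greedily with all pairs
-- good, and consecutive ones are joined through distinct common neighbours.
-- Otherwise the last colour misses at most a fraction of order 1 / s of the edges.
-- Discard the vertices y on the right that miss too many edges, and choose
-- x₁, …, xₙ on the left one at a time; each choice can be made to lose only a
-- fraction 1 / u of the remaining common neighbourhood, with u proportional to s,
-- so at least n common neighbours survive.
module Submission where

open import Data.Bool using (Bool; true; false; _∧_; _∨_; not)
open import Data.Bool.Properties using (∧-comm)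
open import Data.Fin using (Fin; zero; suc; toℕ; fromℕ; fromℕ<; inject₁; _≟_)
import Data.Fin.Properties as Fin
open import Data.Fin.Relation.Unary.Top using (view; ‵fromℕ; ‵inject₁)
open import Data.Integer as ℤ using (+≤+)
import Data.Integer.Properties as ℤ
import Data.Nat.Coprimality as Coprime
open import Data.Nat as ℕ hiding (_≟_)
open import Data.Nat.DivMod using (m%n<n; m≡m%n+[m/n]*n; m%n*o≡m*o%[n*o]; m<n⇒m%n≡m; %-congʳ; n%n≡0)
open import Data.Nat.Induction using (<-rec)
open import Data.Nat.Properties hiding (_≟_)
open import Data.Nat.Tactic.RingSolver using (solve-∀)
open import Data.Product using (Σ-syntax; ∃; ∃-syntax; _×_; _,_; proj₁; proj₂; map₂)
open import Data.Rational as ℚ using (ℚ; mkℚ; *≤*; NonNegative; Positive; ↥_; ↧ₙ_)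
import Data.Rational.Properties as ℚ
open import Data.Sum as Sum using (_⊎_; inj₁; inj₂; [_,_])
open import Data.Sum.Properties using (inj₁-injective; inj₂-injective; ≡-dec)
open import Data.Unit using (tt)
open import Data.Vec.Functional using (Vector; []; _∷_; head; tail)
open import Function using (_∘_; case_of_)
open import Function.Definitions using (Injective)
open import Level using (0ℓ)
open import Relation.Binary.Core using (Rel)
open import Relation.Binary.Definitions
  using (_Respects_; Reflexive; Symmetric; DecidableEquality; tri<; tri≈; tri>)
  renaming (Decidable to Decidable₂)
open import Relation.Binary.PropositionalEquality hiding ([_])
open import Relation.Nullary using (¬_; Dec; yes; no; does; contradiction)
open import Relation.Nullary.Decidable
  using (map′; dec-true; decidable-stable; _×-dec_; _⊎-dec_; _→-dec_; ¬?)
open import Relation.Unary using (Decidable)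
open import Defs
open import Algebra.Properties.Semiring.Sum +-*-semiring

private
  variable
    m n : ℕ
    A B : Set

-- Decidability of the arrow relation

-- Equality of functions is only pointwise, hence the explicit relation.
Searchable : (A : Set) → Rel A 0ℓ → Set₁
Searchable A _≈_ = {P : A → Set} → P Respects _≈_ → Decidable P → Dec (∃ P)

search-Fin : Searchable (Fin n) _≡_
search-Fin _ P? = Fin.any? P?

search-⊎ : Searchable A _≡_ → Searchable B _≡_ → Searchable (A ⊎ B) _≡_
search-⊎ searchA searchB {P} _ P? = map′
  [ (λ (a , p) → inj₁ a , p) , (λ (b , p) → inj₂ b , p) ]
  (λ { (inj₁ a , p) → inj₁ (a , p) ; (inj₂ b , p) → inj₂ (b , p) })
  (searchA (subst (P ∘ inj₁)) (P? ∘ inj₁) ⊎-dec searchB (subst (P ∘ inj₂)) (P? ∘ inj₂))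

search-all : {_≈_ : Rel A 0ℓ} → Searchable A _≈_ → Symmetric _≈_ →
  {P : A → Set} → P Respects _≈_ → Decidable P → Dec (∀ a → P a)
search-all search ≈-sym resp P? = map′
  (λ ¬∃¬ a → decidable-stable (P? a) λ ¬Pa → ¬∃¬ (a , ¬Pa))
  (λ ∀P (a , ¬Pa) → ¬Pa (∀P a))
  (¬? (search (λ a≈b ¬Pa Pb → ¬Pa (resp (≈-sym a≈b) Pb)) (¬? ∘ P?)))

Pointwise : (I : Set) → Rel A 0ℓ → Rel (I → A) 0ℓ
Pointwise I _≈_ f g = ∀ i → f i ≈ g i

-- A vector is searched through its head and its tail. Reassembling them gives a function only
-- pointwise equal to the original, so `resp` carries the property back.
search-Vector : {_≈_ : Rel A 0ℓ} → Reflexive _≈_ → Searchable A _≈_ →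
  ∀ n → Searchable (Vector A n) (Pointwise (Fin n) _≈_)
search-Vector ≈-refl search zero {P} resp P? =
  map′ (λ P[] → [] , P[]) (λ (f , Pf) → resp (λ ()) Pf) (P? [])
search-Vector ≈-refl search (suc n) {P} resp P? = map′
  (λ (a , f , Paf) → a ∷ f , Paf)
  (λ (f , Pf) → head f , tail f , resp (λ { zero → ≈-refl ; (suc i) → ≈-refl }) Pf)
  (search
    (λ a≈b (f , Paf) → f , resp (λ { zero → a≈b ; (suc i) → ≈-refl }) Paf)
    (λ a → search-Vector ≈-refl search n
      (λ f≈g → resp λ { zero → ≈-refl ; (suc i) → f≈g i })
      (λ f → P? (a ∷ f))))

search-from-⊎ : {C : Set} → Searchable (A → C) _≗_ → Searchable (B → C) _≗_ → Searchable (A ⊎ B → C) _≗_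
search-from-⊎ searchA searchB {P} resp P? = map′
  (λ (f , g , Pfg) → [ f , g ] , Pfg)
  (λ (h , Ph) → h ∘ inj₁ , h ∘ inj₂ , resp (λ { (inj₁ _) → refl ; (inj₂ _) → refl }) Ph)
  (searchA
    (λ f≗f′ (g , Pfg) → g , resp (λ { (inj₁ a) → f≗f′ a ; (inj₂ b) → refl }) Pfg)
    (λ f → searchB
      (λ g≗g′ → resp λ { (inj₁ a) → refl ; (inj₂ b) → g≗g′ b })
      (λ g → P? [ f , g ])))

contains? : (G H : Graph) → Searchable (Vertex H) _≡_ → Searchable (Vertex H → Vertex G) _≗_ →
  DecidableEquality (Vertex H) → DecidableEquality (Vertex G) →
  Decidable₂ (Adj H) → Decidable₂ (Adj G) → Dec (Contains G H)
contains? G H searchH searchMap _≟H_ _≟G_ adjH? adjG? = searchMap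
  (λ {f} {g} f≗g (inj , hom) →
    (λ gu≡gv → inj (trans (f≗g _) (trans gu≡gv (sym (f≗g _))))) ,
    λ uv → subst₂ (Adj G) (f≗g _) (f≗g _) (hom uv))
  (λ f → map′ (λ i {u} {v} → i u v) (λ i u v → i {u} {v})
           (∀∀? λ u v → (f u ≟G f v) →-dec (u ≟H v))
         ×-dec
         map′ (λ h {u} {v} → h u v) (λ h u v → h {u} {v})
           (∀∀? λ u v → adjH? u v →-dec adjG? (f u) (f v)))
  where
  ∀∀? : {P : Vertex H → Vertex H → Set} → (∀ u v → Dec (P u v)) → Dec (∀ u v → P u v)
  ∀∀? {P} P? = search-all searchH sym (subst (λ u → ∀ v → P u v))
    λ u → search-all searchH sym (subst (P u)) (P? u)

bipartite-adj? : {R : Fin m → Fin n → Set} → (∀ x y → Dec (R x y)) → Decidable₂ (Adj (bipartite m n R))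
bipartite-adj? R? (inj₁ x) (inj₂ y) = R? x y
bipartite-adj? R? (inj₂ y) (inj₁ x) = R? x y
bipartite-adj? R? (inj₁ _) (inj₁ _) = no λ ()
bipartite-adj? R? (inj₂ _) (inj₂ _) = no λ ()

cycle-adj? : ∀ m → Decidable₂ (Adj (cycle m))
cycle-adj? (suc m) i j = ¬? (i Fin.≟ j) ×-dec ((_ ℕ.≟ _) ⊎-dec (_ ℕ.≟ _))

-- `IsBr` asks for the least arrowing number, and `least` extracts it only from a decidable
-- property. Colours, colourings and vertex maps all range over finite types, so exhaustive search
-- decides it.
arrows? : ∀ k m n N → Dec (Arrows k (cycle m) (completeBipartite n n) N)
arrows? k m n N = search-all
  (search-Vector (λ _ → refl) (search-Vector refl search-Fin N) N)
  (λ χ≈χ′ x y → sym (χ≈χ′ x y))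
  (λ χ≈χ′ → Sum.map (map₂ λ {i} → recolour χ≈χ′ {cycle m} {inject₁ i})
    (recolour χ≈χ′ {completeBipartite n n} {fromℕ k}))
  (λ χ → Fin.any? (λ i → contains? (colourClass χ (inject₁ i)) (cycle m)
             search-Fin (search-Vector refl search-V m)
             Fin._≟_ _≟V_ (cycle-adj? m) (bipartite-adj? λ x y → χ x y Fin.≟ inject₁ i))
         ⊎-dec contains? (colourClass χ (fromℕ k)) (completeBipartite n n)
             (search-⊎ search-Fin search-Fin)
             (search-from-⊎ (search-Vector refl search-V n) (search-Vector refl search-V n))
             (≡-dec Fin._≟_ Fin._≟_) _≟V_
             (bipartite-adj? λ _ _ → yes tt) (bipartite-adj? λ x y → χ x y Fin.≟ fromℕ k))
  where
  search-V : Searchable (Fin N ⊎ Fin N) _≡_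
  search-V = search-⊎ search-Fin search-Fin

  _≟V_ : DecidableEquality (Fin N ⊎ Fin N)
  _≟V_ = ≡-dec Fin._≟_ Fin._≟_

  recolour : {χ χ′ : EdgeColouring N (suc k)} → (∀ x y → χ x y ≡ χ′ x y) →
    ∀ {H i} → Contains (colourClass χ i) H → Contains (colourClass χ′ i) H
  recolour {χ} {χ′} χ≈χ′ {H} {i} (f , inj , hom) = f , inj , λ {u} {v} uv → adj (f u) (f v) (hom uv)
    where
    adj : ∀ a b → Adj (colourClass χ i) a b → Adj (colourClass χ′ i) a b
    adj (inj₁ x) (inj₂ y) e = trans (sym (χ≈χ′ x y)) e
    adj (inj₂ y) (inj₁ x) e = trans (sym (χ≈χ′ x y)) e

-- Well-founded descent: a smaller witness goes to the recursive call, and otherwise `N` itself is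
-- least. The conjunct `L ≤ N` is what later bounds the Ramsey number.
least : {P : ℕ → Set} → Decidable P → ∀ N → P N → ∃[ L ] P L × (∀ M → P M → L ≤ M) × L ≤ N
least {P} P? = <-rec (λ N → P N → ∃[ L ] P L × (∀ M → P M → L ≤ M) × L ≤ N)
  λ N rec PN → case anyUpTo? P? N of λ where
    (yes (M , M<N , PM)) → let (L , PL , L-least , L≤M) = rec M<N PM in
      L , PL , L-least , ≤-trans L≤M (<⇒≤ M<N)
    (no ∄M) → N , PN , (λ M PM → ≮⇒≥ λ M<N → ∄M (M , M<N , PM)) , ≤-refl

-- Counting and greedy choice

sum-mono-≤ : {f g : Vector ℕ n} → (∀ i → f i ≤ g i) → sum f ≤ sum g
sum-mono-≤ {zero}  f≤g = z≤n
sum-mono-≤ {suc n} f≤g = +-mono-≤ (f≤g zero) (sum-mono-≤ (f≤g ∘ suc))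

-- The averaging principle that produces the vertices in `few-badPairs` and `pick-one`.
sum-<⇒∃< : {f g : Vector ℕ n} → sum f < sum g → ∃[ i ] f i < g i
sum-<⇒∃< {f = f} {g} ∑f<∑g with Fin.any? (λ i → f i <? g i)
... | yes ∃i = ∃i
... | no ∄i = contradiction ∑f<∑g (≤⇒≯ (sum-mono-≤ λ i → ≮⇒≥ λ fi<gi → ∄i (i , fi<gi)))

sum-const : ∀ n {c} → ∑[ _ < n ] c ≡ n * c
sum-const zero    = refl
sum-const (suc n) {c} = cong (c +_) (sum-const n)

term≤sum : (f : Vector ℕ n) → ∀ i → f i ≤ sum f
term≤sum f zero    = m≤m+n _ _
term≤sum f (suc i) = ≤-trans (term≤sum (f ∘ suc) i) (m≤n+m _ (f zero))

∑∑-*-comm : (f : Fin m → ℕ) (g : Fin m → Fin n → ℕ) →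
  ∑[ j < n ] ∑[ i < m ] (f i * g i j) ≡ ∑[ i < m ] (f i * ∑[ j < n ] g i j)
∑∑-*-comm f g = trans (sym (∑-comm (λ i j → f i * g i j)))
  (sum-cong-≗ λ i → sym (*-distribˡ-sum (f i) (g i)))

𝟙 : Bool → ℕ
𝟙 true  = 1
𝟙 false = 0

∣_∣ : (Fin n → Bool) → ℕ
∣ S ∣ = sum (𝟙 ∘ S)

𝟙-∧ : ∀ a b → 𝟙 (a ∧ b) ≡ 𝟙 a * 𝟙 b
𝟙-∧ true  b = sym (*-identityˡ (𝟙 b))
𝟙-∧ false b = refl

∧-true : ∀ {a b} → a ∧ b ≡ true → a ≡ true × b ≡ true
∧-true {true} {true} _ = refl , refl

_∖_ : (Fin n → Bool) → (Fin n → Bool) → (Fin n → Bool)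
(A ∖ B) x = A x ∧ not (B x)

∖-true : ∀ {a b} → a ∧ not b ≡ true → a ≡ true × b ≡ false
∖-true {true} {false} _ = refl , refl

∣∖∣ : (A B : Fin n → Bool) → ∣ A ∣ ≡ ∣ A ∖ B ∣ + ∑[ x < n ] (𝟙 (A x) * 𝟙 (B x))
∣∖∣ A B = trans (sum-cong-≗ λ x → split (A x) (B x)) (∑-distrib-+ (𝟙 ∘ (A ∖ B)) _)
  where
  split : ∀ a b → 𝟙 a ≡ 𝟙 (a ∧ not b) + 𝟙 a * 𝟙 b
  split true  true  = refl
  split true  false = refl
  split false _     = refl

eq : Fin n → Fin n → Bool
eq x y = does (x ≟ y)

eq-refl : (x : Fin n) → eq x x ≡ true
eq-refl x = dec-true (x ≟ x) refl

eq-false : {x y : Fin n} → eq x y ≡ false → x ≢ y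
eq-false {x = x} x≠y refl = case trans (sym x≠y) (eq-refl x) of λ ()

∣eq∣ : (x : Fin n) → ∣ eq x ∣ ≡ 1
∣eq∣ {suc n} zero = cong suc (trans (sum-const n) (*-zeroʳ n))
∣eq∣ (suc x) = trans (sum-cong-≗ λ y → cong 𝟙 (suc-eq x y)) (∣eq∣ x)
  where
  suc-eq : (x y : Fin n) → eq (suc x) (suc y) ≡ eq x y
  suc-eq x y with x ≟ y
  ... | yes _ = refl
  ... | no _  = refl

𝟙≤1 : ∀ b → 𝟙 b ≤ 1
𝟙≤1 true  = ≤-refl
𝟙≤1 false = z≤n

𝟙*≤ : ∀ b n → 𝟙 b * n ≤ n
𝟙*≤ b n = ≤-trans (*-monoˡ-≤ n (𝟙≤1 b)) (≤-reflexive (*-identityˡ n))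

∣A∩eq∣≤1 : (A : Fin n → Bool) (x : Fin n) → ∑[ y < n ] (𝟙 (A y) * 𝟙 (eq x y)) ≤ 1
∣A∩eq∣≤1 A x = ≤-trans (sum-mono-≤ λ y → 𝟙*≤ (A y) (𝟙 (eq x y))) (≤-reflexive (∣eq∣ x))

∣∣>0⇒∃ : (A : Fin n → Bool) → 0 < ∣ A ∣ → ∃[ x ] A x ≡ true
∣∣>0⇒∃ {n} A 0<∣A∣ with sum-<⇒∃< {f = λ _ → 0} {𝟙 ∘ A}
  (subst (_< ∣ A ∣) (sym (trans (sum-const n) (*-zeroʳ n))) 0<∣A∣)
... | x , 0<Ax = x , pos (A x) 0<Ax
  where
  pos : ∀ b → 0 < 𝟙 b → b ≡ true
  pos true _ = refl

increasing⇒injective : {A : Set} {v : Fin m → A} →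
  (∀ i j → toℕ i < toℕ j → v i ≢ v j) → Injective _≡_ _≡_ v
increasing⇒injective v≢ {i} {j} vi≡vj with <-cmp (toℕ i) (toℕ j)
... | tri< i<j _ _ = contradiction vi≡vj (v≢ i j i<j)
... | tri≈ _ i≡j _ = Fin.toℕ-injective i≡j
... | tri> _ _ j<i = contradiction (sym vi≡vj) (v≢ j i j<i)

-- The fraction D / q, cleared of its denominator, bounds how many members of any set conflict with
-- a chosen one. Each choice costs each later set at most D / q members, so sizes of at least m D /
-- q survive all choices; `0 < D` keeps the set at hand nonempty.
greedy : ∀ (q D : ℕ) → 0 < D → (A : Fin m → Fin n → Bool) (R : Fin n → Fin n → Bool) →
  (∀ i x → A i x ≡ true → ∀ j → q * ∑[ y < n ] (𝟙 (A j y) * 𝟙 (R x y)) ≤ D) →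
  (∀ i → m * D ≤ q * ∣ A i ∣) →
  Σ[ v ∈ (Fin m → Fin n) ] (∀ i → A i (v i) ≡ true) × (∀ i j → toℕ i < toℕ j → R (v i) (v j) ≡ false)
greedy {zero} q D 0<D A R conflict large = (λ ()) , (λ ()) , λ ()
greedy {suc m} {n} q D 0<D A R conflict large
  with ∣∣>0⇒∃ (A zero) (n≢0⇒n>0 λ ∣A∣≡0 → n≮0 (≤-trans (≤-trans 0<D (m≤m+n D (m * D)))
         (≤-trans (large zero) (≤-reflexive (trans (cong (q *_) ∣A∣≡0) (*-zeroʳ q))))))
... | x , Ax with greedy q D 0<D A′ R conflict′ large′
  where
  A′ : Fin m → Fin n → Bool
  A′ i = A (suc i) ∖ R x

  𝟙-mono : ∀ a b c → 𝟙 (a ∧ not b) * c ≤ 𝟙 a * c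
  𝟙-mono true  b c = ≤-trans (𝟙*≤ (not b) c) (≤-reflexive (sym (*-identityˡ c)))
  𝟙-mono false b c = z≤n

  conflict′ : ∀ i y → A′ i y ≡ true → ∀ j → q * ∑[ z < n ] (𝟙 (A′ j z) * 𝟙 (R y z)) ≤ D
  conflict′ i y A′y j = ≤-trans
    (*-monoʳ-≤ q (sum-mono-≤ λ z → 𝟙-mono (A (suc j) z) (R x z) (𝟙 (R y z))))
    (conflict (suc i) y (proj₁ (∖-true A′y)) (suc j))

  large′ : ∀ i → m * D ≤ q * ∣ A′ i ∣
  large′ i = +-cancelˡ-≤ D _ _ (begin
    D + m * D                ≤⟨ large (suc i) ⟩
    q * ∣ A (suc i) ∣        ≡⟨ cong (q *_) (∣∖∣ (A (suc i)) (R x)) ⟩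
    q * (∣ A′ i ∣ + c)       ≡⟨ *-distribˡ-+ q ∣ A′ i ∣ c ⟩
    q * ∣ A′ i ∣ + q * c     ≤⟨ +-monoʳ-≤ _ (conflict zero x Ax (suc i)) ⟩
    q * ∣ A′ i ∣ + D         ≡⟨ +-comm _ D ⟩
    D + q * ∣ A′ i ∣         ∎)
    where
    open ≤-Reasoning
    c : ℕ
    c = ∑[ y < n ] (𝟙 (A (suc i) y) * 𝟙 (R x y))
... | v , Av , Rv = x ∷ v , Av′ , Rv′
  where
  Av′ : ∀ i → A i ((x ∷ v) i) ≡ true
  Av′ zero    = Ax
  Av′ (suc i) = proj₁ (∖-true (Av i))

  Rv′ : ∀ i j → toℕ i < toℕ j → R ((x ∷ v) i) ((x ∷ v) j) ≡ false
  Rv′ zero    (suc j) _   = proj₂ (∖-true (Av j))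
  Rv′ (suc i) (suc j) i<j = Rv i j (s<s⁻¹ i<j)

-- `greedy` with equality as the conflict: a chosen element rules out only itself, so D / q = 1.
choose-distinct : (A : Fin m → Fin n → Bool) → (∀ i → m ≤ ∣ A i ∣) →
  Σ[ v ∈ (Fin m → Fin n) ] (∀ i → A i (v i) ≡ true) × Injective _≡_ _≡_ v
choose-distinct {m} A large
  with greedy 1 1 ≤-refl A eq
    (λ i x _ j → ≤-trans (≤-reflexive (*-identityˡ _)) (∣A∩eq∣≤1 (A j) x))
    (λ i → subst₂ _≤_ (sym (*-identityʳ m)) (sym (*-identityˡ _)) (large i))
... | v , Av , v≠ = v , Av , increasing⇒injective λ i j i<j → eq-false (v≠ i j i<j)

-- Even cycles in dense bipartite graphs

next : .{{NonZero n}} → Fin n → Fin n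
next {n} i = fromℕ< (m%n<n (suc (toℕ i)) n)

toℕ-next : .{{_ : NonZero n}} (i : Fin n) → toℕ (next i) ≡ suc (toℕ i) % n
toℕ-next {n} i = Fin.toℕ-fromℕ< (m%n<n (suc (toℕ i)) n)

i≢next : .{{_ : NonZero n}} → 2 ≤ n → (i : Fin n) → i ≢ next i
i≢next {n} 2≤n i i≡next with m≤n⇒m<n∨m≡n (Fin.toℕ<n i)
... | inj₁ 1+i<n = 1+n≢n (sym (trans (cong toℕ i≡next) (trans (toℕ-next i) (m<n⇒m%n≡m 1+i<n))))
... | inj₂ 1+i≡n = case ≤-trans 2≤n (≤-reflexive (trans (sym 1+i≡n) (cong suc i≡0))) of λ { (s≤s ()) }
  where
  i≡0 : toℕ i ≡ 0
  i≡0 = trans (cong toℕ i≡next) (trans (toℕ-next i) (trans (cong (_% n) 1+i≡n) (n%n≡0 n)))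

halve : ∀ a n → a < 2 * n → Σ[ i ∈ Fin n ] (a ≡ toℕ i * 2 ⊎ a ≡ suc (toℕ i * 2))
halve zero          (suc n) _ = zero , inj₁ refl
halve (suc zero)    (suc n) _ = zero , inj₂ refl
halve (suc (suc a)) (suc n) 2+a<2n
  with halve a n (s<s⁻¹ (s<s⁻¹ (subst (suc (suc a) <_) (*-suc 2 n) 2+a<2n)))
... | i , inj₁ eq = suc i , inj₁ (cong (2 +_) eq)
... | i , inj₂ eq = suc i , inj₂ (cong (2 +_) eq)

*2≢1+*2 : ∀ i j → i * 2 ≢ suc (j * 2)
*2≢1+*2 i j eq = even≢odd i j (trans (*-comm 2 i) (trans eq (cong suc (*-comm j 2))))

*2-injective : ∀ {n} {i j : Fin n} → toℕ i * 2 ≡ toℕ j * 2 → i ≡ j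
*2-injective eq = Fin.toℕ-injective (*-cancelʳ-≡ _ _ 2 eq)

-- Position 2i of the cycle is the vertex v i and position 2i + 1 is w i.
closed-walk⇒cycle : (R : Fin m → Fin n → Set) (t : ℕ) .{{_ : NonZero t}} (v : Fin t → Fin m) (w : Fin t → Fin n) →
  Injective _≡_ _≡_ v → Injective _≡_ _≡_ w →
  (∀ i → R (v i) (w i)) → (∀ i → R (v (next i)) (w i)) →
  Contains (bipartite m n R) (cycle (2 * t))
closed-walk⇒cycle {m} {n} R t@(suc _) v w v-inj w-inj Rvw Rv′w =
  f , f-inj , λ { {a} {b} (_ , inj₁ ab) → adj a b ab
                ; {a} {b} (_ , inj₂ ba) → adj-sym G {f b} {f a} (adj b a ba) }
  where
  G = bipartite m n R

  place : (a : Fin (2 * t)) → Σ[ i ∈ Fin t ] (toℕ a ≡ toℕ i * 2 ⊎ toℕ a ≡ suc (toℕ i * 2))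
  place a = halve (toℕ a) t (Fin.toℕ<n a)

  f : Fin (2 * t) → Vertex G
  f a with place a
  ... | i , inj₁ _ = inj₁ (v i)
  ... | i , inj₂ _ = inj₂ (w i)

  f-inj : Injective _≡_ _≡_ f
  f-inj {a} {b} fa≡fb with place a | place b
  ... | i , inj₁ a≡ | j , inj₁ b≡ = Fin.toℕ-injective
    (trans a≡ (trans (cong (λ k → toℕ k * 2) (v-inj (inj₁-injective fa≡fb))) (sym b≡)))
  ... | i , inj₂ a≡ | j , inj₂ b≡ = Fin.toℕ-injective
    (trans a≡ (trans (cong (λ k → suc (toℕ k * 2)) (w-inj (inj₂-injective fa≡fb))) (sym b≡)))

  -- Doubling commutes with reduction when the modulus is doubled too, so the wrap-around from the
  -- last `w` to the first `v` is covered.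
  next-even : (i : Fin t) → suc (suc (toℕ i * 2)) % (2 * t) ≡ toℕ (next i) * 2
  next-even i = trans (%-congʳ {o = suc (suc (toℕ i * 2))} (*-comm 2 t))
    (trans (sym (m%n*o≡m*o%[n*o] (suc (toℕ i)) t 2)) (cong (_* 2) (sym (toℕ-next i))))

  next-odd : (i : Fin t) → suc (toℕ i * 2) % (2 * t) ≡ suc (toℕ i * 2)
  next-odd i = m<n⇒m%n≡m (subst (suc (toℕ i * 2) <_) (*-comm t 2) (*-monoˡ-≤ 2 (Fin.toℕ<n i)))

  adj : ∀ a b → Succ a b → Adj G (f a) (f b)
  adj a b ab with place a | place b
  -- The length is even, so successive positions have opposite parity and the two cases of equal
  -- parity are contradictory.
  ... | i , inj₁ a≡ | j , inj₁ b≡ = contradiction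
    (trans (sym b≡) (trans ab (trans (cong (λ k → suc k % (2 * t)) a≡) (next-odd i)))) (*2≢1+*2 (toℕ j) (toℕ i))
  ... | i , inj₁ a≡ | j , inj₂ b≡ = subst (λ k → R (v i) (w k)) i≡j (Rvw i)
    where
    i≡j : i ≡ j
    i≡j = *2-injective (suc-injective (trans (sym (next-odd i))
      (trans (cong (λ k → suc k % (2 * t)) (sym a≡)) (trans (sym ab) b≡))))
  ... | i , inj₂ a≡ | j , inj₁ b≡ = subst (λ k → R (v k) (w i)) i′≡j (Rv′w i)
    where
    i′≡j : next i ≡ j
    i′≡j = *2-injective (trans (sym (next-even i))
      (trans (cong (λ k → suc k % (2 * t)) (sym a≡)) (trans (sym ab) b≡)))
  ... | i , inj₂ a≡ | j , inj₂ b≡ = contradiction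
    (trans (sym (next-even i)) (trans (cong (λ k → suc k % (2 * t)) (sym a≡)) (trans (sym ab) b≡)))
    (*2≢1+*2 (toℕ (next i)) (toℕ j))

-- With the larger number written as the smaller plus `k`, the two sides differ by k².
2*m*n≤m²+n² : ∀ m n → 2 * m * n ≤ n * n + m * m
2*m*n≤m²+n² m n with ≤-total m n
... | inj₁ m≤n with k , refl ← m≤n⇒∃[o]m+o≡n m≤n = ≤-trans (m≤m+n _ (k * k)) (≤-reflexive (lemma m k))
  where
  lemma : ∀ m k → 2 * m * (m + k) + k * k ≡ (m + k) * (m + k) + m * m
  lemma = solve-∀
... | inj₂ n≤m with k , refl ← m≤n⇒∃[o]m+o≡n n≤m = ≤-trans (m≤m+n _ (k * k)) (≤-reflexive (lemma n k))
  where
  lemma : ∀ n k → 2 * (n + k) * n + k * k ≡ n * n + (n + k) * (n + k)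
  lemma = solve-∀

does⇒true : {P : Set} (P? : Dec P) → does P? ≡ true → P
does⇒true (yes p) _ = p

does⇒false : {P : Set} (P? : Dec P) → does P? ≡ false → ¬ P
does⇒false (no ¬p) _ = ¬p

∨-false : ∀ {a b} → a ∨ b ≡ false → a ≡ false × b ≡ false
∨-false {false} {false} _ = refl , refl

module _ (t : ℕ) (E : Fin m → Fin n → Bool) where

  codeg : Fin m → Fin m → ℕ
  codeg x x′ = ∣ (λ y → E x y ∧ E x′ y) ∣

  -- Counting equal pairs as bad makes every tuple without bad pairs injective. With at least `t`
  -- common neighbours per pair, `t` pairs can be joined through distinct vertices.
  bad : Fin m → Fin m → Bool
  bad x x′ = eq x x′ ∨ does (codeg x x′ <? t)

  deg : Fin n → ℕ
  deg y = ∣ (λ x → E x y) ∣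

  -- The degree of `x` into the neighbourhood of `y` in the graph of bad pairs. Summed over the
  -- neighbours of `y` it gives `badPairs y`, so pairs are ordered and the diagonal is included.
  badDeg : Fin n → Fin m → ℕ
  badDeg y x = ∑[ x′ < m ] (𝟙 (bad x x′) * 𝟙 (E x′ y))

  badPairs : Fin n → ℕ
  badPairs y = ∑[ x < m ] (𝟙 (E x y) * badDeg y x)

  codeg-comm : ∀ x x′ → codeg x x′ ≡ codeg x′ x
  codeg-comm x x′ = sum-cong-≗ λ y → cong 𝟙 (∧-comm (E x y) (E x′ y))

  bad-false : ∀ {x x′} → bad x x′ ≡ false → x ≢ x′ × t ≤ codeg x x′
  bad-false {x} {x′} ¬bad with ∨-false {eq x x′} ¬bad
  ... | ≠ , ≮ = eq-false ≠ , ≮⇒≥ (does⇒false (codeg x x′ <? t) ≮)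

  -- Double counting of the triples of a bad pair and a common neighbour of it.
  ∑badPairs : ∑[ y < n ] badPairs y ≡ ∑[ x < m ] ∑[ x′ < m ] (𝟙 (bad x x′) * codeg x x′)
  ∑badPairs = begin
    ∑[ y < n ] badPairs y
      ≡⟨ ∑-comm (λ y x → 𝟙 (E x y) * badDeg y x) ⟩
    ∑[ x < m ] ∑[ y < n ] (𝟙 (E x y) * badDeg y x)
      ≡⟨ sum-cong-≗ (λ x → sum-cong-≗ λ y → trans
           (*-distribˡ-sum (𝟙 (E x y)) (λ x′ → 𝟙 (bad x x′) * 𝟙 (E x′ y)))
           (sum-cong-≗ λ x′ → rearrange x y x′)) ⟩
    ∑[ x < m ] ∑[ y < n ] ∑[ x′ < m ] (𝟙 (bad x x′) * 𝟙 (E x y ∧ E x′ y))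
      ≡⟨ sum-cong-≗ (λ x → ∑∑-*-comm (λ x′ → 𝟙 (bad x x′)) (λ x′ y → 𝟙 (E x y ∧ E x′ y))) ⟩
    ∑[ x < m ] ∑[ x′ < m ] (𝟙 (bad x x′) * codeg x x′) ∎
    where
    open ≡-Reasoning
    lemma : ∀ a b c → a * (b * c) ≡ b * (a * c)
    lemma = solve-∀
    rearrange : ∀ x y x′ → 𝟙 (E x y) * (𝟙 (bad x x′) * 𝟙 (E x′ y)) ≡ 𝟙 (bad x x′) * 𝟙 (E x y ∧ E x′ y)
    rearrange x y x′ = trans (lemma (𝟙 (E x y)) (𝟙 (bad x x′)) (𝟙 (E x′ y)))
      (cong (𝟙 (bad x x′) *_) (sym (𝟙-∧ (E x y) (E x′ y))))

  -- A pair of small codegree contributes at most `t`, and each of the `m` diagonal pairs at most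
  -- `n`.
  ∑badPairs≤ : ∑[ y < n ] badPairs y ≤ m * (m * t + n)
  ∑badPairs≤ = begin
    ∑[ y < n ] badPairs y                                    ≡⟨ ∑badPairs ⟩
    ∑[ x < m ] ∑[ x′ < m ] (𝟙 (bad x x′) * codeg x x′)
      ≤⟨ sum-mono-≤ (λ x → sum-mono-≤ λ x′ → bound (codeg≤n x x′) (eq x x′) (codeg x x′ <? t)) ⟩
    ∑[ x < m ] ∑[ x′ < m ] (t + 𝟙 (eq x x′) * n)             ≡⟨ sum-cong-≗ row ⟩
    ∑[ x < m ] (m * t + n)                                   ≡⟨ sum-const m ⟩
    m * (m * t + n)                                          ∎
    where
    open ≤-Reasoning
    codeg≤n : ∀ x x′ → codeg x x′ ≤ n
    codeg≤n x x′ = ≤-trans (sum-mono-≤ λ y → 𝟙≤1 (E x y ∧ E x′ y))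
      (≤-reflexive (trans (sum-const n) (*-identityʳ n)))

    bound : ∀ {c} → c ≤ n → (a : Bool) (c<t? : Dec (c < t)) → 𝟙 (a ∨ does c<t?) * c ≤ t + 𝟙 a * n
    bound c≤n true  _         = ≤-trans (*-monoʳ-≤ 1 c≤n) (m≤n+m _ t)
    bound c≤n false (yes c<t) = ≤-trans (≤-reflexive (*-identityˡ _)) (≤-trans (<⇒≤ c<t) (m≤m+n t 0))
    bound c≤n false (no _)    = z≤n

    row : ∀ x → ∑[ x′ < m ] (t + 𝟙 (eq x x′) * n) ≡ m * t + n
    row x = trans (∑-distrib-+ {m} (λ _ → t) (λ x′ → 𝟙 (eq x x′) * n))
      (cong₂ _+_ (sum-const m) (trans (sym (*-distribʳ-sum n (𝟙 ∘ eq x)))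
        (trans (cong (_* n) (∣eq∣ x)) (*-identityˡ n))))

  -- Averaging over y; the completed square 2 l d ≤ d² + l² replaces Cauchy-Schwarz.
  few-badPairs : ∀ l → 4 * t * (m * (m * t + n)) + n * (l * l) < 2 * l * ∑[ x < m ] ∑[ y < n ] 𝟙 (E x y) →
    ∃[ y ] 4 * t * badPairs y < deg y * deg y
  few-badPairs l many with sum-<⇒∃< {f = λ y → 4 * t * badPairs y + l * l} {λ y → 2 * l * deg y} (begin-strict
      ∑[ y < n ] (4 * t * badPairs y + l * l)
        ≡⟨ ∑-distrib-+ {n} (λ y → 4 * t * badPairs y) (λ _ → l * l) ⟩
      ∑[ y < n ] (4 * t * badPairs y) + ∑[ y < n ] (l * l)
        ≡⟨ cong₂ _+_ (sym (*-distribˡ-sum (4 * t) badPairs)) (sum-const n) ⟩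
      4 * t * ∑[ y < n ] badPairs y + n * (l * l)
        ≤⟨ +-monoˡ-≤ _ (*-monoʳ-≤ (4 * t) ∑badPairs≤) ⟩
      4 * t * (m * (m * t + n)) + n * (l * l)
        <⟨ many ⟩
      2 * l * ∑[ x < m ] ∑[ y < n ] 𝟙 (E x y)
        ≡⟨ cong (2 * l *_) (∑-comm (λ x y → 𝟙 (E x y))) ⟩
      2 * l * ∑[ y < n ] deg y
        ≡⟨ *-distribˡ-sum (2 * l) deg ⟩
      ∑[ y < n ] (2 * l * deg y) ∎)
    where open ≤-Reasoning
  ... | y , few = y , +-cancelʳ-< (l * l) _ _ (<-≤-trans few (2*m*n≤m²+n² l (deg y)))

  -- At least half of the `d` neighbours of `y` are `Low`: each is in bad pairs with at most d / (2
  -- t) neighbours. Choosing `t` of them greedily needs room for t times d / (2 t), that is d / 2.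
  good-tuple : ∀ y → 4 * t * badPairs y < deg y * deg y →
    Σ[ v ∈ (Fin t → Fin m) ] (∀ i j → toℕ i < toℕ j → bad (v i) (v j) ≡ false)
  good-tuple y few = let (v , _ , vbad) = greedy (2 * t) d 0<d (λ _ → Low) bad conflict (λ _ → large) in v , vbad
    where
    d = deg y

    low? : ∀ x → Dec (2 * t * badDeg y x ≤ d)
    low? x = 2 * t * badDeg y x ≤? d

    Low : Fin m → Bool
    Low x = E x y ∧ does (low? x)

    0<d : 0 < d
    0<d = n≢0⇒n>0 λ d≡0 → n≮0 (subst (λ d → 4 * t * badPairs y < d * d) d≡0 few)

    conflict : ∀ i x → Low x ≡ true → ∀ j → 2 * t * ∑[ x′ < m ] (𝟙 (Low x′) * 𝟙 (bad x x′)) ≤ d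
    conflict _ x Lx _ = ≤-trans (*-monoʳ-≤ (2 * t) (sum-mono-≤ below)) (does⇒true (low? x) (proj₂ (∧-true {E x y} Lx)))
      where
      below : ∀ x′ → 𝟙 (Low x′) * 𝟙 (bad x x′) ≤ 𝟙 (bad x x′) * 𝟙 (E x′ y)
      below x′ = ≤-trans (≤-reflexive (*-comm (𝟙 (Low x′)) _)) (*-monoʳ-≤ (𝟙 (bad x x′)) (≤-trans
        (≤-reflexive (trans (𝟙-∧ (E x′ y) _) (*-comm (𝟙 (E x′ y)) _))) (𝟙*≤ (does (low? x′)) _)))

    -- Markov's inequality, vertex by vertex: for a neighbour that is not low, `2 * t * c` exceeds
    -- `d` and pays for its weight.
    pointwise : ∀ {c} a (low : Dec (2 * t * c ≤ d)) → d * 𝟙 a ≤ d * 𝟙 (a ∧ does low) + 2 * t * (𝟙 a * c)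
    pointwise false _         = ≤-trans (≤-reflexive (*-zeroʳ d)) z≤n
    pointwise true  (yes _)   = m≤m+n _ _
    pointwise true  (no ¬low) = ≤-trans (≤-reflexive (*-identityʳ d)) (≤-trans (<⇒≤ (≰⇒> ¬low))
      (≤-trans (≤-reflexive (cong (2 * t *_) (sym (*-identityˡ _)))) (m≤n+m _ (d * 0))))

    ∑pointwise : d * d ≤ d * ∣ Low ∣ + 2 * t * badPairs y
    ∑pointwise = begin
      d * d
        ≡⟨ *-distribˡ-sum d (λ x → 𝟙 (E x y)) ⟩
      ∑[ x < m ] (d * 𝟙 (E x y))
        ≤⟨ sum-mono-≤ (λ x → pointwise (E x y) (low? x)) ⟩
      ∑[ x < m ] (d * 𝟙 (Low x) + 2 * t * (𝟙 (E x y) * badDeg y x))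
        ≡⟨ ∑-distrib-+ (λ x → d * 𝟙 (Low x)) (λ x → 2 * t * (𝟙 (E x y) * badDeg y x)) ⟩
      ∑[ x < m ] (d * 𝟙 (Low x)) + ∑[ x < m ] (2 * t * (𝟙 (E x y) * badDeg y x))
        ≡⟨ cong₂ _+_ (*-distribˡ-sum d (𝟙 ∘ Low)) (*-distribˡ-sum (2 * t) (λ x → 𝟙 (E x y) * badDeg y x)) ⟨
      d * ∣ Low ∣ + 2 * t * badPairs y ∎
      where open ≤-Reasoning

    d≤2∣A∣ : d ≤ 2 * ∣ Low ∣
    d≤2∣A∣ = <⇒≤ (*-cancelˡ-< d _ _ (+-cancelˡ-< (d * d) _ _ (begin-strict
      -- The Markov bound is added to itself so that `few` absorbs the bad pairs into one copy of
      -- d².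
      d * d + d * d                            ≤⟨ +-mono-≤ ∑pointwise ∑pointwise ⟩
      (d * ∣ Low ∣ + 2 * t * badPairs y) + (d * ∣ Low ∣ + 2 * t * badPairs y)
                                               ≡⟨ lemma d ∣ Low ∣ t (badPairs y) ⟩
      4 * t * badPairs y + d * (2 * ∣ Low ∣)     <⟨ +-monoˡ-< _ few ⟩
      d * d + d * (2 * ∣ Low ∣)                  ∎)))
      where
      open ≤-Reasoning
      lemma : ∀ d a t b → (d * a + 2 * t * b) + (d * a + 2 * t * b) ≡ 4 * t * b + d * (2 * a)
      lemma = solve-∀

    large : t * d ≤ 2 * t * ∣ Low ∣
    large = ≤-trans (*-monoʳ-≤ t d≤2∣A∣) (≤-reflexive (lemma t ∣ Low ∣))
      where
      lemma : ∀ t a → t * (2 * a) ≡ 2 * t * a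
      lemma = solve-∀

-- Cyclically consecutive indices are distinct because 2 ≤ t, so each of the `t` consecutive pairs
-- of a good tuple has at least `t` common neighbours, and distinct connecting vertices exist.
even-cycle : (t : ℕ) → 2 ≤ t → {R : Fin m → Fin n → Set} (R? : ∀ x y → Dec (R x y)) → ∀ l →
  4 * t * (m * (m * t + n)) + n * (l * l) < 2 * l * ∑[ x < m ] ∑[ y < n ] 𝟙 (does (R? x y)) →
  Contains (bipartite m n R) (cycle (2 * t))
even-cycle t@(suc _) 2≤t {R} R? l many =
  let (y , few) = few-badPairs t E l many
      (v , good) = good-tuple t E y few
      (w , vw , w-inj) = choose-distinct (λ i y → E (v i) y ∧ E (v (next i)) y)
        (λ i → codeg≥ v good i (next i) (i≢next 2≤t i))
  in closed-walk⇒cycle R t v w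
      (increasing⇒injective λ i j i<j → proj₁ (bad-false t E (good i j i<j))) w-inj
      (λ i → does⇒true (R? _ _) (proj₁ (∧-true (vw i))))
      (λ i → does⇒true (R? _ _) (proj₂ (∧-true {E (v i) (w i)} (vw i))))
  where
  E : _ → _ → Bool
  E x y = does (R? x y)

  codeg≥ : ∀ v → (∀ i j → toℕ i < toℕ j → bad t E (v i) (v j) ≡ false) →
    ∀ i j → i ≢ j → t ≤ codeg t E (v i) (v j)
  codeg≥ v good i j i≢j with <-cmp (toℕ i) (toℕ j)
  ... | tri< i<j _ _ = proj₂ (bad-false t E (good i j i<j))
  ... | tri≈ _ i≡j _ = contradiction (Fin.toℕ-injective i≡j) i≢j
  -- `good` speaks only of increasing pairs of indices, whereas the pair closing the cycle is
  -- decreasing.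
  ... | tri> _ _ j<i = subst (t ≤_) (codeg-comm t E (v j) (v i)) (proj₂ (bad-false t E (good j i j<i)))

-- Complete bipartite subgraphs of almost complete bipartite graphs

-- M x y says that the edge x y is missing.
module _ {N : ℕ} .{{_ : NonZero N}} (v : ℕ) (M : Fin N → Fin N → Bool)
  (sparse : 4 * suc v * ∑[ x < N ] ∑[ y < N ] 𝟙 (M x y) ≤ N * N) where

  missing : Fin N → ℕ
  missing y = ∑[ x < N ] 𝟙 (M x y)

  few? : ∀ y → Dec (2 * suc v * missing y ≤ N)
  few? y = 2 * suc v * missing y ≤? N

  Few : Fin N → Bool
  Few y = does (few? y)

  -- Markov's inequality: a vertex outside `Few` misses more than N / (2 (v + 1)) edges, and at most
  -- N² / (4 (v + 1)) are missing in all.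
  N≤2∣Few∣ : N ≤ 2 * ∣ Few ∣
  N≤2∣Few∣ = *-cancelˡ-≤ N (+-cancelˡ-≤ (N * N) _ _ (begin
    N * N + N * N
      ≤⟨ +-mono-≤ ∑pointwise ∑pointwise ⟩
    (N * ∣ Few ∣ + 2 * suc v * ∑missing) + (N * ∣ Few ∣ + 2 * suc v * ∑missing)
      ≡⟨ lemma N ∣ Few ∣ (suc v) ∑missing ⟩
    4 * suc v * ∑missing + N * (2 * ∣ Few ∣)
      ≡⟨ cong (λ k → 4 * suc v * k + N * (2 * ∣ Few ∣)) (∑-comm (λ x y → 𝟙 (M x y))) ⟨
    4 * suc v * ∑[ x < N ] ∑[ y < N ] 𝟙 (M x y) + N * (2 * ∣ Few ∣)
      ≤⟨ +-monoˡ-≤ _ sparse ⟩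
    N * N + N * (2 * ∣ Few ∣) ∎))
    where
    open ≤-Reasoning
    ∑missing : ℕ
    ∑missing = sum missing

    lemma : ∀ N a u q → (N * a + 2 * u * q) + (N * a + 2 * u * q) ≡ 4 * u * q + N * (2 * a)
    lemma = solve-∀

    pointwise : ∀ {c} (few : Dec (c ≤ N)) → N ≤ N * 𝟙 (does few) + c
    pointwise (yes _)    = ≤-trans (≤-reflexive (sym (*-identityʳ N))) (m≤m+n _ _)
    pointwise (no ¬few)  = ≤-trans (<⇒≤ (≰⇒> ¬few)) (m≤n+m _ (N * 0))

    ∑pointwise : N * N ≤ N * ∣ Few ∣ + 2 * suc v * ∑missing
    ∑pointwise = begin
      N * N
        ≡⟨ sum-const N ⟨
      ∑[ y < N ] N
        ≤⟨ sum-mono-≤ (λ y → pointwise (few? y)) ⟩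
      ∑[ y < N ] (N * 𝟙 (Few y) + 2 * suc v * missing y)
        ≡⟨ ∑-distrib-+ (λ y → N * 𝟙 (Few y)) (λ y → 2 * suc v * missing y) ⟩
      ∑[ y < N ] (N * 𝟙 (Few y)) + ∑[ y < N ] (2 * suc v * missing y)
        ≡⟨ cong₂ _+_ (*-distribˡ-sum N (𝟙 ∘ Few)) (*-distribˡ-sum (2 * suc v) missing) ⟨
      N * ∣ Few ∣ + 2 * suc v * ∑missing ∎

  missingIn : (Fin N → Bool) → Fin N → ℕ
  missingIn B x = ∑[ y < N ] (𝟙 (B y) * 𝟙 (M x y))

  -- As `B` lies in `Few`, at most ∣ B ∣ N / (2 (v + 1)) edges into `B` are missing. Averaged over
  -- the more than N / 2 members of `A`, this is at most ∣ B ∣ / (v + 1) each.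
  pick-one : (A B : Fin N → Bool) → N + 2 ≤ 2 * ∣ A ∣ → (∀ y → B y ≡ true → Few y ≡ true) →
    ∃[ x ] A x ≡ true × suc v * missingIn B x ≤ ∣ B ∣
  pick-one A B A-large B⊆Few = case
    -- Comparing with `suc ∣ B ∣` is strict even for empty `B`, and strictness at `x` forces `A x`,
    -- since both sides vanish off `A`.
    sum-<⇒∃< {f = λ x → 2 * (𝟙 (A x) * (suc v * missingIn B x))} {λ x → 2 * (𝟙 (A x) * suc ∣ B ∣)} ∑<
    of λ (x , fx<gx) → x , extract (A x) (*-cancelˡ-< 2 _ _ fx<gx)
    where
    open ≤-Reasoning
    extract : ∀ a {c d} → 𝟙 a * c < 𝟙 a * suc d → a ≡ true × c ≤ d
    extract true c<d = refl , s≤s⁻¹ (subst₂ _<_ (*-identityˡ _) (*-identityˡ _) c<d)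

    pointwise : ∀ b {c} → (b ≡ true → 2 * suc v * c ≤ N) → 2 * suc v * (𝟙 b * c) ≤ 𝟙 b * N
    pointwise true {c} few = subst₂ _≤_ (cong (2 * suc v *_) (sym (*-identityˡ c))) (sym (*-identityˡ N)) (few refl)
    pointwise false _ = ≤-reflexive (*-zeroʳ (2 * suc v))

    ∑< : ∑[ x < N ] (2 * (𝟙 (A x) * (suc v * missingIn B x))) < ∑[ x < N ] (2 * (𝟙 (A x) * suc ∣ B ∣))
    ∑< = begin-strict
      ∑[ x < N ] (2 * (𝟙 (A x) * (suc v * missingIn B x)))
        ≤⟨ sum-mono-≤ (λ x → *-monoʳ-≤ 2 (𝟙*≤ (A x) _)) ⟩
      ∑[ x < N ] (2 * (suc v * missingIn B x))
        ≡⟨ sum-cong-≗ (λ x → *-assoc 2 (suc v) (missingIn B x)) ⟨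
      ∑[ x < N ] (2 * suc v * missingIn B x)
        ≡⟨ *-distribˡ-sum (2 * suc v) (missingIn B) ⟨
      2 * suc v * ∑[ x < N ] missingIn B x
        ≡⟨ cong (2 * suc v *_) (∑∑-*-comm (𝟙 ∘ B) (λ y x → 𝟙 (M x y))) ⟩
      2 * suc v * ∑[ y < N ] (𝟙 (B y) * missing y)
        ≡⟨ *-distribˡ-sum (2 * suc v) (λ y → 𝟙 (B y) * missing y) ⟩
      ∑[ y < N ] (2 * suc v * (𝟙 (B y) * missing y))
        ≤⟨ sum-mono-≤ (λ y → pointwise (B y) (λ By → does⇒true (few? y) (B⊆Few y By))) ⟩
      ∑[ y < N ] (𝟙 (B y) * N)
        ≡⟨ *-distribʳ-sum N (𝟙 ∘ B) ⟨
      ∣ B ∣ * N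
        ≤⟨ *-monoʳ-≤ ∣ B ∣ (m≤m+n N 2) ⟩
      ∣ B ∣ * (N + 2)
        <⟨ *-monoˡ-< (N + 2) {{>-nonZero (<-≤-trans z<s (m≤n+m 2 N))}} (n<1+n ∣ B ∣) ⟩
      suc ∣ B ∣ * (N + 2)
        ≤⟨ *-monoʳ-≤ (suc ∣ B ∣) A-large ⟩
      suc ∣ B ∣ * (2 * ∣ A ∣)
        ≡⟨ lemma ∣ A ∣ (suc ∣ B ∣) ⟩
      2 * (∣ A ∣ * suc ∣ B ∣)
        ≡⟨ cong (2 *_) (*-distribʳ-sum (suc ∣ B ∣) (𝟙 ∘ A)) ⟩
      2 * ∑[ x < N ] (𝟙 (A x) * suc ∣ B ∣)
        ≡⟨ *-distribˡ-sum 2 (λ x → 𝟙 (A x) * suc ∣ B ∣) ⟩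
      ∑[ x < N ] (2 * (𝟙 (A x) * suc ∣ B ∣)) ∎
      where
      lemma : ∀ a b → b * (2 * a) ≡ 2 * (a * b)
      lemma = solve-∀

  remove-one : ∀ (A : Fin N → Bool) x j → N + suc j * 2 ≤ 2 * ∣ A ∣ → N + j * 2 ≤ 2 * ∣ A ∖ eq x ∣
  remove-one A x j A-large = +-cancelʳ-≤ 2 _ _ (begin
    N + j * 2 + 2                  ≡⟨ lemma N j ⟩
    N + suc j * 2                  ≤⟨ A-large ⟩
    2 * ∣ A ∣                      ≡⟨ cong (2 *_) (∣∖∣ A (eq x)) ⟩
    2 * (∣ A ∖ eq x ∣ + _)        ≤⟨ *-monoʳ-≤ 2 (+-monoʳ-≤ ∣ A ∖ eq x ∣ (∣A∩eq∣≤1 A x)) ⟩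
    2 * (∣ A ∖ eq x ∣ + 1)        ≡⟨ *-distribˡ-+ 2 ∣ A ∖ eq x ∣ 1 ⟩
    2 * ∣ A ∖ eq x ∣ + 2          ∎)
    where
    open ≤-Reasoning
    lemma : ∀ N j → N + j * 2 + 2 ≡ N + suc j * 2
    lemma = solve-∀

  -- `b`, `b₁` and `b′` are the sizes of the common neighbourhood before a choice, after it and at
  -- the end. Losing at most b / (v + 1) keeps a fraction v / (v + 1), which multiplies the ratio p
  -- / q of the later choices.
  decay-step : ∀ p q c {b b₁ b′} → b ≡ b₁ + c → suc v * c ≤ b → p * b₁ ≤ q * b′ → v * p * b ≤ suc v * q * b′
  decay-step p q c {b} {b₁} {b′} b≡ c≤ pb₁≤ = begin
    v * p * b             ≡⟨ lemma₁ v p b ⟩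
    p * (v * b)           ≤⟨ *-monoʳ-≤ p shrink ⟩
    p * (suc v * b₁)      ≡⟨ lemma₂ (suc v) p b₁ ⟩
    suc v * (p * b₁)      ≤⟨ *-monoʳ-≤ (suc v) pb₁≤ ⟩
    suc v * (q * b′)      ≡⟨ *-assoc (suc v) q b′ ⟨
    suc v * q * b′        ∎
    where
    open ≤-Reasoning
    lemma₁ : ∀ v p b → v * p * b ≡ p * (v * b)
    lemma₁ = solve-∀
    lemma₂ : ∀ u p b → p * (u * b) ≡ u * (p * b)
    lemma₂ = solve-∀
    shrink : v * b ≤ suc v * b₁
    shrink = +-cancelˡ-≤ b _ _ (begin
      suc v * b                  ≡⟨ cong (suc v *_) b≡ ⟩
      suc v * (b₁ + c)           ≡⟨ *-distribˡ-+ (suc v) b₁ c ⟩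
      suc v * b₁ + suc v * c     ≤⟨ +-monoʳ-≤ _ c≤ ⟩
      suc v * b₁ + b             ≡⟨ +-comm _ b ⟩
      b + suc v * b₁             ∎)

  -- `A` holds the left vertices still available and `B` the current common neighbourhood. With `j`
  -- choices to go, `A` keeps at least N / 2 + j members, so `pick-one` applies each time.
  pick : ∀ j (A B : Fin N → Bool) → N + j * 2 ≤ 2 * ∣ A ∣ → (∀ y → B y ≡ true → Few y ≡ true) →
    Σ[ x ∈ (Fin j → Fin N) ] Σ[ B′ ∈ (Fin N → Bool) ]
      (∀ i → A (x i) ≡ true) × (∀ i i′ → toℕ i < toℕ i′ → x i ≢ x i′) ×
      (∀ y → B′ y ≡ true → B y ≡ true × (∀ i → M (x i) y ≡ false)) ×
      v ^ j * ∣ B ∣ ≤ suc v ^ j * ∣ B′ ∣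
  pick zero A B A-large B⊆Few = (λ ()) , B , (λ ()) , (λ ()) , (λ _ By → By , λ ()) , ≤-refl
  pick (suc j) A B A-large B⊆Few =
    let (x₀ , Ax₀ , nearly) = pick-one A B (≤-trans (+-monoʳ-≤ N (m≤m+n 2 (j * 2))) A-large) B⊆Few
        (x , B′ , Ax , x≢ , B′⊆ , decay) = pick j (A ∖ eq x₀) (B ∖ M x₀) (remove-one A x₀ j A-large)
          (λ y B₁y → B⊆Few y (proj₁ (∖-true B₁y)))
    in x₀ ∷ x , B′ ,
      (λ { zero → Ax₀ ; (suc i) → proj₁ (∖-true (Ax i)) }) ,
      (λ { zero (suc i) _ → eq-false (proj₂ (∖-true {A (x i)} (Ax i)))
         ; (suc i) (suc i′) i<i′ → x≢ i i′ (s<s⁻¹ i<i′) }) ,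
      (λ y B′y → let (B₁y , Mxy) = B′⊆ y B′y ; (By , Mx₀y) = ∖-true {B y} B₁y in
        By , λ { zero → Mx₀y ; (suc i) → Mxy i }) ,
      decay-step (v ^ j) (suc v ^ j) (missingIn B x₀) (∣∖∣ B (M x₀)) nearly decay

  -- Starting from `Few`, of size at least N / 2, the common neighbourhood ends with at least (v /
  -- (v + 1))^n N / 2 vertices, which the last hypothesis makes at least `n`.
  biclique : {R : Fin N → Fin N → Set} → (∀ x y → M x y ≡ false → R x y) →
    ∀ n → 2 * n ≤ N → suc v ^ n * (2 * n) ≤ v ^ n * N →
    Contains (bipartite N N R) (completeBipartite n n)
  biclique {R} ¬M⇒R n 2n≤N decay-small =
    let (x , B , _ , x≢ , B-good , decay) = pick n (λ _ → true) Few A-large (λ _ By → By)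
        (y , By , y-inj) = choose-distinct {n} (λ _ → B) (λ _ → n≤∣B∣ decay)
    in [ inj₁ ∘ x , inj₂ ∘ y ] ,
      (λ { {inj₁ i} {inj₁ j} e → cong inj₁ (increasing⇒injective x≢ (inj₁-injective e))
         ; {inj₂ i} {inj₂ j} e → cong inj₂ (y-inj (inj₂-injective e)) }) ,
      λ { {inj₁ i} {inj₂ j} _ → ¬M⇒R _ _ (proj₂ (B-good (y j) (By j)) i)
        ; {inj₂ j} {inj₁ i} _ → ¬M⇒R _ _ (proj₂ (B-good (y j) (By j)) i) }
    where
    open ≤-Reasoning
    A-large : N + n * 2 ≤ 2 * ∣ (λ (_ : Fin N) → true) ∣
    A-large = begin
      N + n * 2          ≡⟨ cong (N +_) (*-comm n 2) ⟩
      N + 2 * n          ≤⟨ +-monoʳ-≤ N 2n≤N ⟩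
      N + N              ≡⟨ lemma N ⟩
      2 * (N * 1)        ≡⟨ cong (2 *_) (sum-const N) ⟨
      2 * ∣ (λ (_ : Fin N) → true) ∣ ∎
      where
      lemma : ∀ N → N + N ≡ 2 * (N * 1)
      lemma = solve-∀

    n≤∣B∣ : ∀ {b} → v ^ n * ∣ Few ∣ ≤ suc v ^ n * b → n ≤ b
    n≤∣B∣ {b} decay = *-cancelˡ-≤ 2 (*-cancelˡ-≤ (suc v ^ n) {{m^n≢0 (suc v) n}} (begin
      suc v ^ n * (2 * n)        ≤⟨ decay-small ⟩
      v ^ n * N                  ≤⟨ *-monoʳ-≤ (v ^ n) N≤2∣Few∣ ⟩
      v ^ n * (2 * ∣ Few ∣)      ≡⟨ lemma (v ^ n) ∣ Few ∣ ⟩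
      2 * (v ^ n * ∣ Few ∣)      ≤⟨ *-monoʳ-≤ 2 decay ⟩
      2 * (suc v ^ n * b)        ≡⟨ lemma (suc v ^ n) b ⟨
      suc v ^ n * (2 * b)        ∎))
      where
      lemma : ∀ p q → p * (2 * q) ≡ 2 * (p * q)
      lemma = solve-∀

-- The choice of parameters

-- Bernoulli's inequality (1 - 1 / u)^n ≥ 1 - n / u for u = v + 1, multiplied by u^(n + 1).
bernoulli : ∀ v n → suc v ^ n * suc v ≤ v ^ n * suc v + n * suc v ^ n
bernoulli v zero = m≤m+n _ 0
bernoulli v (suc n) = begin
  suc v * suc v ^ n * suc v                              ≡⟨ *-assoc (suc v) (suc v ^ n) (suc v) ⟩
  suc v * (suc v ^ n * suc v)                            ≤⟨ *-monoʳ-≤ (suc v) (bernoulli v n) ⟩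
  suc v * (v ^ n * suc v + n * suc v ^ n)                ≡⟨ lemma v (v ^ n) n (suc v ^ n) ⟩
  suc v * v ^ n + (v * v ^ n * suc v + n * (suc v * suc v ^ n))
    ≤⟨ +-monoˡ-≤ _ (*-monoʳ-≤ (suc v) (^-monoˡ-≤ n (n≤1+n v))) ⟩
  suc v * suc v ^ n + (v * v ^ n * suc v + n * (suc v * suc v ^ n))
    ≡⟨ lemma₂ (suc v * suc v ^ n) (v * v ^ n * suc v) n ⟩
  v * v ^ n * suc v + suc n * (suc v * suc v ^ n)        ∎
  where
  open ≤-Reasoning
  lemma : ∀ v p n q → suc v * (p * suc v + n * q) ≡ suc v * p + (v * p * suc v + n * (suc v * q))
  lemma = solve-∀
  lemma₂ : ∀ a b n → a + (b + n * a) ≡ b + suc n * a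
  lemma₂ = solve-∀

-- `bernoulli` with n / (v + 1) at most 1 / 2.
halving : ∀ v n → 2 * n ≤ suc v → suc v ^ n ≤ 2 * v ^ n
halving v n 2n≤ = *-cancelˡ-≤ (suc v) (+-cancelʳ-≤ (suc v * suc v ^ n) _ _ (begin
  suc v * suc v ^ n + suc v * suc v ^ n             ≡⟨ lemma₁ (suc v) (suc v ^ n) ⟩
  2 * (suc v ^ n * suc v)                           ≤⟨ *-monoʳ-≤ 2 (bernoulli v n) ⟩
  2 * (v ^ n * suc v + n * suc v ^ n)               ≡⟨ lemma₂ (suc v) (v ^ n) n (suc v ^ n) ⟩
  suc v * (2 * v ^ n) + 2 * n * suc v ^ n           ≤⟨ +-monoʳ-≤ _ (*-monoˡ-≤ (suc v ^ n) 2n≤) ⟩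
  suc v * (2 * v ^ n) + suc v * suc v ^ n           ∎))
  where
  open ≤-Reasoning
  lemma₁ : ∀ u q → u * q + u * q ≡ 2 * (q * u)
  lemma₁ = solve-∀
  lemma₂ : ∀ u p n q → 2 * (p * u + n * q) ≡ u * (2 * p) + 2 * n * q
  lemma₂ = solve-∀

-- The exponent is cut into at most `h` blocks of length at most `w`, each costing a factor 2 by
-- `halving`.
decay : ∀ v w → 2 * w ≤ suc v → ∀ h n → n ≤ w * h → suc v ^ n ≤ 2 ^ h * v ^ n
decay v w 2w≤ zero n n≤ with refl ← n≤0⇒n≡0 (≤-trans n≤ (≤-reflexive (*-zeroʳ w))) = ≤-refl
decay v w 2w≤ (suc h) n n≤ with ≤-total n w
... | inj₁ n≤w = begin
  suc v ^ n            ≤⟨ halving v n (≤-trans (*-monoʳ-≤ 2 n≤w) 2w≤) ⟩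
  2 * v ^ n            ≤⟨ *-monoˡ-≤ (v ^ n) (*-monoʳ-≤ 2 (m^n>0 2 h)) ⟩
  2 ^ suc h * v ^ n    ∎
  where open ≤-Reasoning
... | inj₂ w≤n with n′ , refl ← m≤n⇒∃[o]m+o≡n w≤n = begin
  suc v ^ (w + n′)                     ≡⟨ ^-distribˡ-+-* (suc v) w n′ ⟩
  suc v ^ w * suc v ^ n′               ≤⟨ *-mono-≤ (halving v w 2w≤) (decay v w 2w≤ h n′ n′≤) ⟩
  (2 * v ^ w) * (2 ^ h * v ^ n′)       ≡⟨ lemma (v ^ w) (2 ^ h) (v ^ n′) ⟩
  2 ^ suc h * (v ^ w * v ^ n′)         ≡⟨ cong (2 ^ suc h *_) (^-distribˡ-+-* v w n′) ⟨
  2 ^ suc h * v ^ (w + n′)             ∎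
  where
  open ≤-Reasoning
  lemma : ∀ p q r → (2 * p) * (q * r) ≡ 2 * q * (p * r)
  lemma = solve-∀
  n′≤ : n′ ≤ w * h
  n′≤ = +-cancelˡ-≤ w _ _ (≤-trans n≤ (≤-reflexive (*-suc w h)))

n<2^n : ∀ n → n < 2 ^ n
n<2^n zero    = s≤s z≤n
n<2^n (suc n) = begin
  2 + n            ≤⟨ +-mono-≤ (m^n>0 2 n) (n<2^n n) ⟩
  2 ^ n + 2 ^ n    ≡⟨ cong (2 ^ n +_) (+-identityʳ (2 ^ n)) ⟨
  2 ^ suc n        ∎
  where open ≤-Reasoning

n²≤4*2^n : ∀ n → n * n ≤ 4 * 2 ^ n
n²≤4*2^n zero    = z≤n
n²≤4*2^n (suc n) = begin
  suc n * suc n                       ≤⟨ m≤m+n _ 1 ⟩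
  suc n * suc n + 1                   ≡⟨ lemma₁ n ⟩
  n * n + 2 * suc n                   ≤⟨ +-mono-≤ (n²≤4*2^n n) (*-monoʳ-≤ 2 (n<2^n n)) ⟩
  4 * 2 ^ n + 2 * 2 ^ n               ≤⟨ m≤m+n _ (2 * 2 ^ n) ⟩
  4 * 2 ^ n + 2 * 2 ^ n + 2 * 2 ^ n   ≡⟨ lemma₂ (2 ^ n) ⟩
  4 * 2 ^ suc n                       ∎
  where
  open ≤-Reasoning
  lemma₁ : ∀ n → suc n * suc n + 1 ≡ n * n + 2 * suc n
  lemma₁ = solve-∀
  lemma₂ : ∀ p → 4 * p + 2 * p + 2 * p ≡ 4 * (2 * p)
  lemma₂ = solve-∀

log₄ : ∀ n → 1 ≤ n → ∃[ h ] 4 ^ h ≤ n × n < 4 ^ suc h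
log₄ (suc zero) _ = 0 , ≤-refl , s≤s (s≤s z≤n)
log₄ (suc n@(suc _)) _ with log₄ n (s≤s z≤n)
... | h , 4^h≤n , n<4^1+h with suc n <? 4 ^ suc h
...   | yes 1+n< = h , ≤-trans 4^h≤n (n≤1+n n) , 1+n<
...   | no 1+n≮ = suc h , ≮⇒≥ 1+n≮ , ≤-<-trans n<4^1+h (^-monoʳ-< 4 (s≤s (s≤s z≤n)) (n<1+n (suc h)))

-- `h` is log₄ n up to rounding and `w` is of order n / h, hence n / log n. Base 4 makes 2^h, the
-- total loss in `decay`, at most the square root of `n`.
record Parameters (n : ℕ) : Set where
  field
    h w       : ℕ
    1≤h       : 1 ≤ h
    1≤w       : 1 ≤ w
    4^h≤n     : 4 ^ h ≤ n
    n≤4^[1+h] : n ≤ 4 ^ suc h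
    n≤w*h     : n ≤ w * h
    w*h≤2*n   : w * h ≤ 2 * n

parameters : ∀ n → 4 ≤ n → Parameters n
parameters n 4≤n with log₄ n (≤-trans (s≤s z≤n) 4≤n)
... | zero , _ , n<4 = contradiction 4≤n (<⇒≱ n<4)
... | h@(suc _) , 4^h≤n , n<4^1+h = record
  -- The successor rounds the quotient up, so w h reaches `n`; the excess is at most `h`, hence at
  -- most `n`.
  { h = h ; w = suc (n / h) ; 1≤h = s≤s z≤n ; 1≤w = s≤s z≤n
  ; 4^h≤n = 4^h≤n ; n≤4^[1+h] = <⇒≤ n<4^1+h
  ; n≤w*h = ≤-trans (≤-reflexive n≡) (+-monoˡ-≤ _ (<⇒≤ (m%n<n n h)))
  ; w*h≤2*n = begin
      h + n / h * h                 ≤⟨ +-mono-≤ h≤n (≤-trans (m≤n+m (n / h * h) (n % h)) (≤-reflexive (sym n≡))) ⟩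
      n + n                         ≡⟨ cong (n +_) (+-identityʳ n) ⟨
      2 * n                         ∎
  }
  where
  open ≤-Reasoning
  n≡ : n ≡ n % h + n / h * h
  n≡ = m≡m%n+[m/n]*n n h
  h≤n : h ≤ n
  h≤n = ≤-trans (<⇒≤ (n<2^n h)) (≤-trans (^-monoˡ-≤ h (s≤s (s≤s z≤n))) 4^h≤n)

module _ {n} (p : Parameters n) where
  open Parameters p
  open ≤-Reasoning

  -- After multiplication by h², the bound h² ≤ 4 · 2^h turns the left side into 8 n 4^h ≤ 8 n², and
  -- n ≤ w h finishes. This leaves enough common neighbours after the loss of 2^h.
  2*n*2^h≤8*w² : 2 * n * 2 ^ h ≤ 8 * (w * w)
  2*n*2^h≤8*w² = *-cancelʳ-≤ _ _ (h * h) {{>-nonZero (*-mono-≤ 1≤h 1≤h)}} (begin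
    2 * n * 2 ^ h * (h * h)            ≤⟨ *-monoʳ-≤ (2 * n * 2 ^ h) (n²≤4*2^n h) ⟩
    2 * n * 2 ^ h * (4 * 2 ^ h)        ≡⟨ lemma₁ n (2 ^ h) ⟩
    8 * n * (2 ^ h * 2 ^ h)            ≡⟨ cong (8 * n *_) 2^h*2^h≡4^h ⟩
    8 * n * 4 ^ h                      ≤⟨ *-monoʳ-≤ (8 * n) 4^h≤n ⟩
    8 * n * n                          ≡⟨ *-assoc 8 n n ⟩
    8 * (n * n)                        ≤⟨ *-monoʳ-≤ 8 (*-mono-≤ n≤w*h n≤w*h) ⟩
    8 * ((w * h) * (w * h))            ≡⟨ lemma₂ w h ⟩
    8 * (w * w) * (h * h)              ∎)
    where
    lemma₁ : ∀ n p → 2 * n * p * (4 * p) ≡ 8 * n * (p * p)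
    lemma₁ = solve-∀
    lemma₂ : ∀ w h → 8 * ((w * h) * (w * h)) ≡ 8 * (w * w) * (h * h)
    lemma₂ = solve-∀
    2^h*2^h≡4^h : 2 ^ h * 2 ^ h ≡ 4 ^ h
    2^h*2^h≡4^h = trans (sym (^-distribˡ-+-* 2 h h))
      (trans (cong (λ k → 2 ^ (h + k)) (sym (+-identityʳ h))) (sym (^-*-assoc 2 2 h)))

  -- With N = (8 K w)² and 4 h an upper bound for log₂ n, this is the final estimate. The constant
  -- 64 is 8 · 4 doubled by w h ≤ 2 n.
  N*[4*h]²≤ : ∀ K → (8 * K * w) * (8 * K * w) * (4 * h * (4 * h)) ≤ (64 * K) * (64 * K) * (n * n)
  N*[4*h]²≤ K = begin
    (8 * K * w) * (8 * K * w) * (4 * h * (4 * h))        ≡⟨ lemma₁ K w h ⟩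
    (32 * K) * (32 * K) * ((w * h) * (w * h))            ≤⟨ *-monoʳ-≤ ((32 * K) * (32 * K)) (*-mono-≤ w*h≤2*n w*h≤2*n) ⟩
    (32 * K) * (32 * K) * ((2 * n) * (2 * n))            ≡⟨ lemma₂ K n ⟩
    (64 * K) * (64 * K) * (n * n)                        ∎
    where
    lemma₁ : ∀ K w h → (8 * K * w) * (8 * K * w) * (4 * h * (4 * h)) ≡ (32 * K) * (32 * K) * ((w * h) * (w * h))
    lemma₁ = solve-∀
    lemma₂ : ∀ K n → (32 * K) * (32 * K) * ((2 * n) * (2 * n)) ≡ (64 * K) * (64 * K) * (n * n)
    lemma₂ = solve-∀

  -- Here a / b is a rational below log₂ n. From n ≤ 4^(h + 1) it is at most 2 (h + 1), which is at
  -- most 4 h as h ≥ 1.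
  logs≤4h : ∀ a b → 2 ^ a ≤ n ^ b → a ≤ 4 * h * b
  logs≤4h a b 2^a≤n^b = ≤-trans (≮⇒≥ λ 2[1+h]b<a → <⇒≱ (^-monoʳ-< 2 (s≤s (s≤s z≤n)) 2[1+h]b<a) 2^a≤)
    (*-monoˡ-≤ b 2[1+h]≤4h)
    where
    2[1+h]≤4h : 2 * suc h ≤ 4 * h
    2[1+h]≤4h = begin
      2 * suc h      ≤⟨ *-monoʳ-≤ 2 (+-monoˡ-≤ h 1≤h) ⟩
      2 * (h + h)    ≡⟨ lemma h ⟩
      4 * h          ∎
      where
      lemma : ∀ h → 2 * (h + h) ≡ 4 * h
      lemma = solve-∀
    2^a≤ : 2 ^ a ≤ 2 ^ (2 * suc h * b)
    2^a≤ = begin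
      2 ^ a                   ≤⟨ 2^a≤n^b ⟩
      n ^ b                   ≤⟨ ^-monoˡ-≤ b n≤4^[1+h] ⟩
      (4 ^ suc h) ^ b         ≡⟨ cong (_^ b) (^-*-assoc 2 2 (suc h)) ⟩
      (2 ^ (2 * suc h)) ^ b   ≡⟨ ^-*-assoc 2 (2 * suc h) b ⟩
      2 ^ (2 * suc h * b)     ∎

-- From natural to rational inequalities

fromNat≡mkℚ : ∀ n → fromNat n ≡ mkℚ (ℤ.+ n) 0 (Coprime.sym (Coprime.1-coprimeTo n))
-- `ℚ./` normalises by a gcd that does not compute for a variable `n`; the `mkℚ` form exposes
-- numerator and denominator.
fromNat≡mkℚ n = ℚ.↥p/↧p≡p (mkℚ (ℤ.+ n) 0 (Coprime.sym (Coprime.1-coprimeTo n)))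

fromNat-* : ∀ m n → fromNat m ℚ.* fromNat n ≡ fromNat (m * n)
fromNat-* m n rewrite fromNat≡mkℚ m | fromNat≡mkℚ n = cong (ℚ._/ 1) (sym (ℤ.pos-* m n))

fromNat-mono-≤ : ∀ {m n} → m ≤ n → fromNat m ℚ.≤ fromNat n
fromNat-mono-≤ {m} {n} m≤n rewrite fromNat≡mkℚ m | fromNat≡mkℚ n =
  *≤* (ℤ.*-monoʳ-≤-nonNeg (ℤ.+ 1) (+≤+ m≤n))

fromNat-nonNeg : ∀ n → NonNegative (fromNat n)
fromNat-nonNeg n rewrite fromNat≡mkℚ n = _

fromNat-pos : ∀ n .{{_ : NonZero n}} → Positive (fromNat n)
fromNat-pos n@(suc _) rewrite fromNat≡mkℚ n = _

≤fromNat : ∀ q → NonNegative q → ∀ m → ℤ.∣ ↥ q ∣ ≤ m * ↧ₙ q → q ℚ.≤ fromNat m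
≤fromNat (mkℚ (ℤ.+ a) b-1 _) _ m a≤mb rewrite fromNat≡mkℚ m =
  *≤* (subst₂ ℤ._≤_ (sym (ℤ.*-identityʳ (ℤ.+ a))) (ℤ.pos-* m (suc b-1)) (+≤+ a≤mb))

-- `m` is an upper bound for log₂ n, so each admissible `q` is at most `m` and the inequality with
-- m² implies the one with q².
fromNat-≤-n²/log² : ∀ N c n m → (∀ a b → 2 ^ a ≤ n ^ b → a ≤ m * b) →
  N * (m * m) ≤ c * (n * n) → N ≤ fromNat c ·n²/log² n
fromNat-≤-n²/log² N c n m logs≤m Nm²≤cn² q q≥0 q≤log = begin
  fromNat N ℚ.* (q ℚ.* q)
    ≤⟨ ℚ.*-monoˡ-≤-nonNeg (fromNat N) {{fromNat-nonNeg N}} q²≤m² ⟩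
  fromNat N ℚ.* (fromNat m ℚ.* fromNat m)
    ≡⟨ cong (fromNat N ℚ.*_) (fromNat-* m m) ⟩
  fromNat N ℚ.* fromNat (m * m)
    ≡⟨ fromNat-* N (m * m) ⟩
  fromNat (N * (m * m))
    ≤⟨ fromNat-mono-≤ Nm²≤cn² ⟩
  fromNat (c * (n * n))
    ≡⟨ fromNat-* c (n * n) ⟨
  fromNat c ℚ.* fromNat (n * n)
    ≡⟨ cong (fromNat c ℚ.*_) (fromNat-* n n) ⟨
  fromNat c ℚ.* (fromNat n ℚ.* fromNat n) ∎
  where
  open ℚ.≤-Reasoning
  q≤m : q ℚ.≤ fromNat m
  q≤m = ≤fromNat q q≥0 m (logs≤m _ _ q≤log)
  q²≤m² : q ℚ.* q ℚ.≤ fromNat m ℚ.* fromNat m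
  q²≤m² = ℚ.≤-trans (ℚ.*-monoˡ-≤-nonNeg q {{q≥0}} q≤m)
    (ℚ.*-monoʳ-≤-nonNeg (fromNat m) {{fromNat-nonNeg m}} q≤m)

-- Colour classes and the Ramsey bound

module _ {k N : ℕ} (χ : EdgeColouring N (suc k)) where

  edges : Fin (suc k) → ℕ
  edges c = ∑[ x < N ] ∑[ y < N ] 𝟙 (does (χ x y ≟ c))

  notLast : Fin N → Fin N → Bool
  notLast x y = not (does (χ x y ≟ fromℕ k))

  -- An edge outside the last colour is counted on the right under its own colour.
  ∑notLast≤ : ∑[ x < N ] ∑[ y < N ] 𝟙 (notLast x y) ≤ ∑[ i < k ] edges (inject₁ i)
  ∑notLast≤ = begin
    ∑[ x < N ] ∑[ y < N ] 𝟙 (notLast x y)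
      ≤⟨ sum-mono-≤ (λ x → sum-mono-≤ λ y → pointwise (χ x y)) ⟩
    ∑[ x < N ] ∑[ y < N ] ∑[ i < k ] 𝟙 (does (χ x y ≟ inject₁ i))
      ≡⟨ sum-cong-≗ (λ x → ∑-comm (λ y i → 𝟙 (does (χ x y ≟ inject₁ i)))) ⟩
    ∑[ x < N ] ∑[ i < k ] ∑[ y < N ] 𝟙 (does (χ x y ≟ inject₁ i))
      ≡⟨ ∑-comm (λ x i → ∑[ y < N ] 𝟙 (does (χ x y ≟ inject₁ i))) ⟩
    ∑[ i < k ] edges (inject₁ i) ∎
    where
    open ≤-Reasoning
    pointwise : ∀ c → 𝟙 (not (does (c ≟ fromℕ k))) ≤ ∑[ i < k ] 𝟙 (does (c ≟ inject₁ i))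
    pointwise c with view c
    ... | ‵fromℕ = ≤-trans (≤-reflexive (cong (𝟙 ∘ not) (dec-true (fromℕ k ≟ fromℕ k) refl))) z≤n
    ... | ‵inject₁ i = begin
      𝟙 (not (does (inject₁ i ≟ fromℕ k)))            ≤⟨ 𝟙≤1 (not (does (inject₁ i ≟ fromℕ k))) ⟩
      1                                                ≡⟨ cong 𝟙 (dec-true (inject₁ i ≟ inject₁ i) refl) ⟨
      𝟙 (does (inject₁ i ≟ inject₁ i))                ≤⟨ term≤sum (λ j → 𝟙 (does (inject₁ i ≟ inject₁ j))) i ⟩
      ∑[ j < k ] 𝟙 (does (inject₁ i ≟ inject₁ j))     ∎

-- Either one of the first `k` colours has 2 (t + 1) s³ edges and contains the cycle, or together
-- they have at most 2 k (t + 1) s³. The value of `s` makes 4 (v + 1) times the latter equal to s⁴,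
-- as `biclique` requires.
arrows : ∀ t k v s n .{{_ : NonZero s}} → 2 ≤ t → s ≡ 4 * (k * (2 * suc t)) * suc v →
  2 * n ≤ s * s → suc v ^ n * (2 * n) ≤ v ^ n * (s * s) →
  Arrows k (cycle (2 * t)) (completeBipartite n n) (s * s)
arrows t k v s n 2≤t s≡ 2n≤ decay-small χ
  with Fin.any? (λ i → 2 * suc t * (s * s * s) ≤? edges χ (inject₁ i))
... | yes (i , dense) = inj₁ (i , even-cycle t 2≤t (λ x y → χ x y ≟ inject₁ i) l (begin-strict
    4 * t * (s * s * (s * s * t + s * s)) + s * s * (l * l)
      <⟨ m<m+n _ (>-nonZero⁻¹ _ {{m*n≢0 (4 * suc t) (s * s * (s * s)) {{it}} {{m*n≢0 (s * s) (s * s) {{s²≢0}} {{s²≢0}}}}}}) ⟩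
    4 * t * (s * s * (s * s * t + s * s)) + s * s * (l * l) + 4 * suc t * (s * s * (s * s))
      ≡⟨ lemma t s ⟩
    2 * l * (2 * suc t * (s * s * s))
      ≤⟨ *-monoʳ-≤ (2 * l) dense ⟩
    2 * l * edges χ (inject₁ i) ∎))
  where
  open ≤-Reasoning
  -- The average right degree at exactly 2 (t + 1) s³ edges, where the completed square is tight.
  -- The two sides then differ by 4 (t + 1) s⁴, whence the strict inequality.
  l : ℕ
  l = 2 * suc t * s
  s²≢0 : NonZero (s * s)
  s²≢0 = m*n≢0 s s
  it : NonZero (4 * suc t)
  it = m*n≢0 4 (suc t)
  lemma : ∀ t s → 4 * t * (s * s * (s * s * t + s * s)) + s * s * (2 * suc t * s * (2 * suc t * s)) + 4 * suc t * (s * s * (s * s))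
    ≡ 2 * (2 * suc t * s) * (2 * suc t * (s * s * s))
  lemma = solve-∀
... | no sparse = inj₂ (biclique {{m*n≢0 s s}} v (notLast χ) few (λ x y → last (χ x y ≟ fromℕ k)) n 2n≤ decay-small)
  where
  open ≤-Reasoning
  last : {P : Set} (P? : Dec P) → not (does P?) ≡ false → P
  last (yes p) _ = p

  few : 4 * suc v * ∑[ x < s * s ] ∑[ y < s * s ] 𝟙 (notLast χ x y) ≤ s * s * (s * s)
  few = begin
    4 * suc v * ∑[ x < s * s ] ∑[ y < s * s ] 𝟙 (notLast χ x y)
      ≤⟨ *-monoʳ-≤ (4 * suc v) (∑notLast≤ χ) ⟩
    4 * suc v * ∑[ i < k ] edges χ (inject₁ i)
      ≤⟨ *-monoʳ-≤ (4 * suc v) (sum-mono-≤ λ i → <⇒≤ (≰⇒> λ dense → sparse (i , dense))) ⟩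
    4 * suc v * ∑[ i < k ] (2 * suc t * (s * s * s))
      ≡⟨ cong (4 * suc v *_) (sum-const k) ⟩
    4 * suc v * (k * (2 * suc t * (s * s * s)))
      ≡⟨ lemma₁ (suc v) k (2 * suc t) (s * s * s) ⟩
    4 * (k * (2 * suc t)) * suc v * (s * s * s)
      ≡⟨ cong (_* (s * s * s)) s≡ ⟨
    s * (s * s * s)
      ≡⟨ lemma₂ s ⟩
    s * s * (s * s) ∎
    where
    lemma₁ : ∀ u k C s³ → 4 * u * (k * (C * s³)) ≡ 4 * (k * C) * u * s³
    lemma₁ = solve-∀
    lemma₂ : ∀ s → s * (s * s * s) ≡ s * s * (s * s)
    lemma₂ = solve-∀

arrows-parameters : ∀ t k n → 2 ≤ t → 1 ≤ k → (p : Parameters n) →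
  let s = 8 * (k * (2 * suc t)) * Parameters.w p in
  Arrows k (cycle (2 * t)) (completeBipartite n n) (s * s)
arrows-parameters t k n 2≤t 1≤k p = arrows t k v s n {{>-nonZero 1≤s}} 2≤t s≡ 2n≤s² decay-small
  where
  open Parameters p
  open ≤-Reasoning
  K = k * (2 * suc t)
  s = 8 * K * w
  -- Then v + 1 = 2 w meets the hypothesis of `decay` with equality, and s = 8 K w becomes 4 K (v +
  -- 1), as `arrows` demands.
  v = pred (2 * w)

  1≤K : 1 ≤ K
  1≤K = *-mono-≤ 1≤k (s≤s {n = t + 1 * suc t} z≤n)

  8w≤s : 8 * w ≤ s
  8w≤s = *-monoˡ-≤ w (*-monoʳ-≤ 8 1≤K)

  1≤s : 1 ≤ s
  1≤s = ≤-trans (*-mono-≤ {1} {8} (s≤s z≤n) 1≤w) 8w≤s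

  2w≡ : 2 * w ≡ suc v
  2w≡ = sym (suc-pred (2 * w) {{>-nonZero (*-mono-≤ {1} {2} (s≤s z≤n) 1≤w)}})

  s≡ : s ≡ 4 * K * suc v
  s≡ = trans (lemma K w) (cong (4 * K *_) 2w≡)
    where
    lemma : ∀ K w → 8 * K * w ≡ 4 * K * (2 * w)
    lemma = solve-∀

  2n2^h≤s² : 2 * n * 2 ^ h ≤ s * s
  2n2^h≤s² = begin
    2 * n * 2 ^ h            ≤⟨ 2*n*2^h≤8*w² p ⟩
    8 * (w * w)              ≤⟨ *-monoˡ-≤ (w * w) (m≤m+n 8 56) ⟩
    64 * (w * w)             ≡⟨ lemma w ⟩
    (8 * w) * (8 * w)        ≤⟨ *-mono-≤ 8w≤s 8w≤s ⟩
    s * s                    ∎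
    where
    lemma : ∀ w → 64 * (w * w) ≡ (8 * w) * (8 * w)
    lemma = solve-∀

  2n≤s² : 2 * n ≤ s * s
  2n≤s² = ≤-trans (m≤m*n (2 * n) (2 ^ h) {{m^n≢0 2 h}}) 2n2^h≤s²

  decay-small : suc v ^ n * (2 * n) ≤ v ^ n * (s * s)
  decay-small = begin
    suc v ^ n * (2 * n)           ≤⟨ *-monoˡ-≤ (2 * n) (decay v w (≤-reflexive 2w≡) h n n≤w*h) ⟩
    2 ^ h * v ^ n * (2 * n)       ≡⟨ lemma (2 ^ h) (v ^ n) (2 * n) ⟩
    v ^ n * (2 * n * 2 ^ h)       ≤⟨ *-monoʳ-≤ (v ^ n) 2n2^h≤s² ⟩
    v ^ n * (s * s)               ∎
    where
    lemma : ∀ a b c → a * b * c ≡ b * (c * a)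
    lemma = solve-∀

theorem2 : (t k : ℕ) → 2 ≤ t → 2 ≤ k →
    ∃[ c ] Positive c × (∃[ n₀ ] ((n : ℕ) → n₀ ≤ n →
    ∃[ N ] IsBr k (cycle (2 * t)) (completeBipartite n n) N × N ≤ c ·n²/log² n))
-- The threshold 4 ensures h ≥ 1. The least arrowing number is at most s², so it inherits the
-- estimate for s².
theorem2 t k 2≤t 2≤k = fromNat c , fromNat-pos c {{c≢0}} , 4 , λ n 4≤n →
  let p = parameters n 4≤n
      open Parameters p
      s = 8 * K * w
      (N , arr , N-least , N≤s²) = least (arrows? k (2 * t) n) (s * s)
        (arrows-parameters t k n 2≤t 1≤k p)
  in N , (arr , N-least) , fromNat-≤-n²/log² N c n (4 * h) (logs≤4h p)
       (≤-trans (*-monoˡ-≤ (4 * h * (4 * h)) N≤s²) (N*[4*h]²≤ p K))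
  where
  1≤k : 1 ≤ k
  1≤k = ≤-trans (s≤s z≤n) 2≤k
  K = k * (2 * suc t)
  c = (64 * K) * (64 * K)
  64K≢0 : NonZero (64 * K)
  64K≢0 = m*n≢0 64 K {{_}} {{m*n≢0 k (2 * suc t) {{>-nonZero 1≤k}}}}
  c≢0 : NonZero c
  c≢0 = m*n≢0 (64 * K) (64 * K) {{64K≢0}} {{64K≢0}}
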